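{- Let $G$ be a cubic graph with $n$ vertices and let $\mathcal{M}(G)$ be the magnification of $G$. Then $G$ admits an efficient edge dominating set if and only if $\mathcal{M}(G)$ has a perfect edge dominating set of size at most $\frac{57n}{10}$.
   Context: Graphs are finite, simple and undirected. An edge dominates itself and every edge sharing an endpoint with it. A set $P\subseteq E(G)$ is a perfect edge dominating set if every edge of $E(G)\setminus P$ is dominated by exactly one edge of $P$; it is an efficient edge dominating set if every edge of $E(G)$ is dominated by exactly one edge of $P$. The shield graph has vertices $v_1,\dots,v_{12}$ and edges $v_iv_{i+1}$ ($1\le i\le 11$), $v_{12}v_1$, $v_2v_4$, $v_6v_8$, $v_{10}v_{12}$; its contact vertices are $v_3,v_7,v_{11}$. For a cubic graph $G$, the magnification $\mathcal{M}(G)$ is obtained by replacing every vertex $v$ of $G$ by a copy $S_v$ of the shield graph, fixing for each $v$ a bijection between the three neighbours of $v$ in $G$ and the three contact vertices of $S_v$, and, for each edge $uv$ of $G$, adding an edge between the contact vertex of $S_u$ assigned to $v$ and the contact vertex of $S_v$ assigned to $u$. -}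

module Defs where

open import Data.Nat using (ℕ; zero; suc; _+_; _*_; _<ᵇ_; _≡ᵇ_)
open import Data.Bool using (Bool; true; false; _∧_; _∨_; if_then_else_)
open import Data.Fin using (Fin; toℕ; remQuot; combine)
open import Data.Fin.Properties using (_≟_)
open import Data.Product using (Σ; _×_; _,_; proj₁; proj₂)
open import Data.Sum using (_⊎_)
open import Relation.Binary.PropositionalEquality using (_≡_)
open import Relation.Nullary.Decidable using (⌊_⌋)

Adj : ℕ → Set
Adj n = Fin n → Fin n → Bool

IsSimpleGraph : ∀ {n} → Adj n → Set
IsSimpleGraph {n} adj = (∀ (i j : Fin n) → adj i j ≡ adj j i) × (∀ (i : Fin n) → adj i i ≡ false)

countF : ∀ {n} → (Fin n → Bool) → ℕ
countF {zero}  p = 0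
countF {suc n} p = (if p Fin.zero then 1 else 0) + countF (λ i → p (Fin.suc i))
  where import Data.Fin as Fin

sumF : ∀ {n} → (Fin n → ℕ) → ℕ
sumF {zero}  f = 0
sumF {suc n} f = f Fin.zero + sumF (λ i → f (Fin.suc i))
  where import Data.Fin as Fin

degree : ∀ {n} → Adj n → Fin n → ℕ
degree adj v = countF (adj v)

IsCubic : ∀ {n} → Adj n → Set
IsCubic {n} adj = ∀ (v : Fin n) → degree adj v ≡ 3

-- An edge {x,y} is represented by an adjacent pair (x , y) (in either order).
SameEdge : ∀ {n} → Fin n → Fin n → Fin n → Fin n → Set
SameEdge x y u v = (x ≡ u × y ≡ v) ⊎ (x ≡ v × y ≡ u)

Dominates : ∀ {n} → Fin n → Fin n → Fin n → Fin n → Set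
Dominates x y u v = (x ≡ u ⊎ x ≡ v) ⊎ (y ≡ u ⊎ y ≡ v)

IsEdgeSet : ∀ {n} → Adj n → Adj n → Set
IsEdgeSet {n} adj P = (∀ (i j : Fin n) → P i j ≡ P j i) × (∀ (i j : Fin n) → P i j ≡ true → adj i j ≡ true)

edgeCount : ∀ {n} → Adj n → ℕ
edgeCount P = sumF (λ i → countF (λ j → P i j ∧ (toℕ i <ᵇ toℕ j)))

DominatedExactlyOnce : ∀ {n} → Adj n → Fin n → Fin n → Set
DominatedExactlyOnce {n} P u v =
  Σ (Fin n) λ x → Σ (Fin n) λ y →
    (P x y ≡ true) × Dominates x y u v ×
    (∀ (x' y' : Fin n) → P x' y' ≡ true → Dominates x' y' u v → SameEdge x y x' y')

IsPerfectEDS : ∀ {n} → Adj n → Adj n → Set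
IsPerfectEDS {n} adj P =
  IsEdgeSet adj P ×
  (∀ (u v : Fin n) → adj u v ≡ true → P u v ≡ false → DominatedExactlyOnce P u v)

IsEfficientEDS : ∀ {n} → Adj n → Adj n → Set
IsEfficientEDS {n} adj P =
  IsEdgeSet adj P ×
  (∀ (u v : Fin n) → adj u v ≡ true → DominatedExactlyOnce P u v)

HasEfficientEDS : ∀ {n} → Adj n → Set
HasEfficientEDS {n} adj = Σ (Adj n) λ P → IsEfficientEDS adj P

-- The shield graph, vertices v₁..v₁₂ encoded as Fin 12 with v_k ↦ k-1.
-- Edges: v_i v_{i+1} (1≤i≤11), v₁₂v₁, v₂v₄, v₆v₈, v₁₀v₁₂.

shieldArc : Fin 12 → Fin 12 → Bool
shieldArc a b =
  (toℕ b ≡ᵇ suc (toℕ a)) ∨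
  ((toℕ a ≡ᵇ 11) ∧ (toℕ b ≡ᵇ 0)) ∨
  ((toℕ a ≡ᵇ 1) ∧ (toℕ b ≡ᵇ 3)) ∨
  ((toℕ a ≡ᵇ 5) ∧ (toℕ b ≡ᵇ 7)) ∨
  ((toℕ a ≡ᵇ 9) ∧ (toℕ b ≡ᵇ 11))

shieldAdj : Adj 12
shieldAdj a b = shieldArc a b ∨ shieldArc b a

-- contact vertices v₃, v₇, v₁₁ (indices 2, 6, 10)
contact : Fin 3 → Fin 12
contact c = Data.Fin.fromℕ< {4 * toℕ c + 2} (prf c)
  where
    import Data.Fin
    open import Data.Nat using (_<_; s≤s; z≤n)
    prf : (c : Fin 3) → 4 * toℕ c + 2 < 12
    prf Data.Fin.zero = s≤s (s≤s (s≤s z≤n))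
    prf (Data.Fin.suc Data.Fin.zero) = s≤s (s≤s (s≤s (s≤s (s≤s (s≤s (s≤s z≤n))))))
    prf (Data.Fin.suc (Data.Fin.suc Data.Fin.zero)) =
      s≤s (s≤s (s≤s (s≤s (s≤s (s≤s (s≤s (s≤s (s≤s (s≤s (s≤s z≤n))))))))))

-- A contact assignment: σ v w is the contact vertex of S_v assigned to the
-- neighbour w of v. It must be injective on the neighbours of v; since G is
-- cubic (v has exactly 3 neighbours) this is exactly a bijection between
-- N(v) and the three contact vertices. Values at non-neighbours are irrelevant.
IsContactAssignment : ∀ {n} → Adj n → (Fin n → Fin n → Fin 3) → Set
IsContactAssignment {n} adj σ =
  ∀ (v w w' : Fin n) → adj v w ≡ true → adj v w' ≡ true → σ v w ≡ σ v w' → w ≡ w'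

-- Magnification: vertex (v , a) of S_v is encoded as combine v a : Fin (n * 12).
magAdj' : ∀ {n} → Adj n → (Fin n → Fin n → Fin 3) → (Fin n × Fin 12) → (Fin n × Fin 12) → Bool
magAdj' adj σ (v , a) (w , b) =
  if ⌊ v ≟ w ⌋
  then shieldAdj a b
  else (adj v w ∧ ⌊ a ≟ contact (σ v w) ⌋ ∧ ⌊ b ≟ contact (σ w v) ⌋)

magnification : ∀ {n} → Adj n → (Fin n → Fin n → Fin 3) → Adj (n * 12)
magnification {n} adj σ x y = magAdj' adj σ (remQuot 12 x) (remQuot 12 y)

{-# OPTIONS --safe #-}

-- Let P be a perfect edge dominating set of the magnification, and let R be the set of edges of G
-- whose copies between two shields lie in P. Inside one shield P is determined by the edges of P
-- leaving it: if r of them do, the P-degrees over the shield sum to 6 + 9r, and a contact vertex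
-- whose outer edge is not in P has P-degree r. Hence R is a perfect edge dominating set of G, and
-- |P| = 3n + 9|R|, so |P| ≤ 57n/10 says |R| ≤ 3n/10. In a cubic graph each edge of R dominates
-- five edges, so 5|R| counts the 3n/2 edges of G, each at least once; therefore |R| ≤ 3n/10 holds
-- exactly when every edge is dominated once.

module Submission where

open import Defs
open import Data.Nat using (ℕ; zero; suc; _+_; _*_; _≤_; _<_; _<ᵇ_; _≡ᵇ_; z≤n; s≤s; _≤?_)
open import Data.Nat.Properties as ℕ hiding (_≟_)
open import Data.Nat.Tactic.RingSolver using (solve-∀)
open import Data.Bool using (Bool; true; false; _∧_; _∨_; not; if_then_else_; T)
open import Data.Bool.ListAction using (any)
import Data.Bool.Properties as Bool
open import Data.Fin using (Fin; zero; suc; toℕ; remQuot; combine; _↑ˡ_; _↑ʳ_; _≟_)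
open import Data.Fin.Patterns
open import Data.Fin.Properties using (all?; toℕ-injective; remQuot-combine; combine-remQuot)
open import Data.List using (List; []; _∷_; _++_)
open import Data.Product using (Σ; ∃; _×_; _,_; proj₁; proj₂)
open import Data.Sum using (_⊎_; inj₁; inj₂)
open import Data.Empty using (⊥-elim)
open import Function using (_∘_)
open import Function.Bundles using (_⇔_; mk⇔)
open import Relation.Nullary using (¬_; Dec; yes; no; contradiction)
open import Relation.Nullary.Decidable using (⌊_⌋; _→-dec_; _×-dec_; from-yes; map′)
open import Relation.Binary.Definitions using (tri<; tri≈; tri>)
open import Relation.Binary.PropositionalEquality
open import Algebra.Properties.CommutativeMonoid.Sum +-0-commutativeMonoid using (sum; ∑-comm; ∑-distrib-+)

-- Truth values as numbers and decisions

⟦_⟧ : Bool → ℕ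
⟦ b ⟧ = if b then 1 else 0

⟦_⟧≤1 : ∀ b → ⟦ b ⟧ ≤ 1
⟦ true ⟧≤1  = s≤s z≤n
⟦ false ⟧≤1 = z≤n

∧-trueˡ : ∀ {a b} → a ∧ b ≡ true → a ≡ true
∧-trueˡ {true} _ = refl

∧-trueʳ : ∀ {a b} → a ∧ b ≡ true → b ≡ true
∧-trueʳ {true} h = h

true≢false : ∀ {b} → b ≡ true → b ≡ false → ∀ {A : Set} → A
true≢false refl ()

¬true⇒false : ∀ {b} → ¬ (b ≡ true) → b ≡ false
¬true⇒false {true}  h = ⊥-elim (h refl)
¬true⇒false {false} h = refl

⌊⌋-true : ∀ {A : Set} (a? : Dec A) → A → ⌊ a? ⌋ ≡ true
⌊⌋-true (yes _) a = refl
⌊⌋-true (no ¬a) a = contradiction a ¬a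

⌊⌋-false : ∀ {A : Set} (a? : Dec A) → ¬ A → ⌊ a? ⌋ ≡ false
⌊⌋-false (yes a) ¬a = contradiction a ¬a
⌊⌋-false (no _)  ¬a = refl

⌊⌋-sound : ∀ {A : Set} (a? : Dec A) → ⌊ a? ⌋ ≡ true → A
⌊⌋-sound (yes a) _ = a

-- Finite sums and counts

sumF-cong : ∀ {n} {f g : Fin n → ℕ} → (∀ i → f i ≡ g i) → sumF f ≡ sumF g
sumF-cong {zero}  f≗g = refl
sumF-cong {suc n} f≗g = cong₂ _+_ (f≗g zero) (sumF-cong (f≗g ∘ suc))

sumF≡sum : ∀ {n} (f : Fin n → ℕ) → sumF f ≡ sum f
sumF≡sum {zero}  f = refl
sumF≡sum {suc n} f = cong (f zero +_) (sumF≡sum (f ∘ suc))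

sumF-+ : ∀ {n} (f g : Fin n → ℕ) → sumF (λ i → f i + g i) ≡ sumF f + sumF g
sumF-+ f g = begin
  sumF (λ i → f i + g i) ≡⟨ sumF≡sum (λ i → f i + g i) ⟩
  sum (λ i → f i + g i)  ≡⟨ ∑-distrib-+ f g ⟩
  sum f + sum g          ≡⟨ sym (cong₂ _+_ (sumF≡sum f) (sumF≡sum g)) ⟩
  sumF f + sumF g        ∎
  where open ≡-Reasoning

sumF-swap : ∀ {m n} (f : Fin m → Fin n → ℕ) →
  sumF (λ i → sumF (f i)) ≡ sumF (λ j → sumF (λ i → f i j))
sumF-swap f = begin
  sumF (λ i → sumF (f i))         ≡⟨ double f ⟩
  sum (λ i → sum (f i))           ≡⟨ ∑-comm f ⟩
  sum (λ j → sum (λ i → f i j))   ≡⟨ sym (double (λ j i → f i j)) ⟩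
  sumF (λ j → sumF (λ i → f i j)) ∎
  where
  open ≡-Reasoning
  double : ∀ {m n} (g : Fin m → Fin n → ℕ) → sumF (λ i → sumF (g i)) ≡ sum (λ i → sum (g i))
  double g = trans (sumF-cong (λ i → sumF≡sum (g i))) (sumF≡sum (λ i → sum (g i)))

sumF-*ˡ : ∀ {n} k (f : Fin n → ℕ) → sumF (λ i → k * f i) ≡ k * sumF f
sumF-*ˡ {zero}  k f = sym (*-zeroʳ k)
sumF-*ˡ {suc n} k f =
  trans (cong (k * f zero +_) (sumF-*ˡ k (f ∘ suc))) (sym (*-distribˡ-+ k (f zero) (sumF (f ∘ suc))))

sumF-const : ∀ n k → sumF {n} (λ _ → k) ≡ n * k
sumF-const zero    k = refl
sumF-const (suc n) k = cong (k +_) (sumF-const n k)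

sumF-mono-≤ : ∀ {n} {f g : Fin n → ℕ} → (∀ i → f i ≤ g i) → sumF f ≤ sumF g
sumF-mono-≤ {zero}  f≤g = z≤n
sumF-mono-≤ {suc n} f≤g = +-mono-≤ (f≤g zero) (sumF-mono-≤ (f≤g ∘ suc))

-- A strict inequality at one index could not be made up elsewhere. This turns every counting bound
-- below into termwise equality.
sumF-rigid : ∀ {n} {f g : Fin n → ℕ} → (∀ i → f i ≤ g i) → sumF g ≤ sumF f → ∀ i → f i ≡ g i
sumF-rigid {suc n} {f} {g} f≤g Σg≤Σf zero = ≤-antisym (f≤g zero)
  (+-cancelʳ-≤ (sumF (f ∘ suc)) (g zero) (f zero)
    (≤-trans (+-monoʳ-≤ (g zero) (sumF-mono-≤ (f≤g ∘ suc))) Σg≤Σf))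
sumF-rigid {suc n} {f} {g} f≤g Σg≤Σf (suc i) = sumF-rigid (f≤g ∘ suc)
  (+-cancelˡ-≤ (f zero) (sumF (g ∘ suc)) (sumF (f ∘ suc))
    (≤-trans (+-monoˡ-≤ (sumF (g ∘ suc)) (f≤g zero)) Σg≤Σf)) i

sumF-zero : ∀ {n} {f : Fin n → ℕ} → (∀ i → f i ≡ 0) → sumF f ≡ 0
sumF-zero {n} f≗0 = trans (sumF-cong f≗0) (trans (sumF-const n 0) (*-zeroʳ n))

sumF-single : ∀ {n} {f : Fin n → ℕ} i → (∀ j → j ≢ i → f j ≡ 0) → sumF f ≡ f i
sumF-single {suc n} {f} zero off =
  trans (cong (f zero +_) (sumF-zero (λ j → off (suc j) (λ ())))) (+-identityʳ (f zero))
sumF-single {suc n} {f} (suc i) off = trans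
  (cong (_+ sumF (f ∘ suc)) (off zero (λ ())))
  (sumF-single i (λ j j≢i → off (suc j) (λ { refl → j≢i refl })))

sumF-↑ : ∀ m {n} (f : Fin (m + n) → ℕ) → sumF f ≡ sumF (λ i → f (i ↑ˡ n)) + sumF (λ j → f (m ↑ʳ j))
sumF-↑ zero    f = refl
sumF-↑ (suc m) f = trans (cong (f zero +_) (sumF-↑ m (f ∘ suc))) (sym (+-assoc (f zero) _ _))

sumF-combine : ∀ m {k} (f : Fin (m * k) → ℕ) → sumF f ≡ sumF (λ i → sumF (λ j → f (combine {m} {k} i j)))
sumF-combine zero        f = refl
sumF-combine (suc m) {k} f =
  trans (sumF-↑ k f) (cong (sumF (λ j → f (j ↑ˡ m * k)) +_) (sumF-combine m (λ j → f (k ↑ʳ j))))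

countF≡sumF : ∀ {n} (p : Fin n → Bool) → countF p ≡ sumF (λ i → ⟦ p i ⟧)
countF≡sumF {zero}  p = refl
countF≡sumF {suc n} p = cong (⟦ p zero ⟧ +_) (countF≡sumF (p ∘ suc))

countF-cong : ∀ {n} {p q : Fin n → Bool} → (∀ i → p i ≡ q i) → countF p ≡ countF q
countF-cong {zero}  p≗q = refl
countF-cong {suc n} p≗q = cong₂ _+_ (cong ⟦_⟧ (p≗q zero)) (countF-cong (p≗q ∘ suc))

countF-single : ∀ {n} {p : Fin n → Bool} i → (∀ j → p j ≡ true → j ≡ i) → countF p ≡ ⟦ p i ⟧
countF-single {p = p} i only = trans (countF≡sumF p)
  (sumF-single i (λ j j≢i → cong ⟦_⟧ (¬true⇒false (j≢i ∘ only j))))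

countF-pos : ∀ {n} {p : Fin n → Bool} i → p i ≡ true → 1 ≤ countF p
countF-pos {suc n} {p} zero    pi rewrite pi = s≤s z≤n
countF-pos {suc n} {p} (suc i) pi = ≤-trans (countF-pos i pi) (m≤n+m _ ⟦ p zero ⟧)

countF-witness : ∀ {n} {p : Fin n → Bool} → 1 ≤ countF p → ∃ λ i → p i ≡ true
countF-witness {suc n} {p} h with p zero in eq
... | true  = zero , eq
... | false with i , pi ← countF-witness h = suc i , pi

countF-≤1 : ∀ {n} {p : Fin n → Bool} → (∀ i j → p i ≡ true → p j ≡ true → i ≡ j) → countF p ≤ 1
countF-≤1 {p = p} unique with countF p in eq
... | zero  = z≤n
... | suc k with i , pi ← countF-witness {p = p} (≤-trans (s≤s z≤n) (≤-reflexive (sym eq))) =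
  ≤-trans (≤-reflexive (trans (sym eq) (countF-single i (λ j pj → unique j i pj pi)))) ⟦ p i ⟧≤1

countF-none : ∀ {n} {p : Fin n → Bool} → countF p ≡ 0 → ∀ i → p i ≡ false
countF-none h i = ¬true⇒false λ pi → <⇒≢ (countF-pos i pi) (sym h)

countF-unique : ∀ {n} {p : Fin n → Bool} → countF p ≤ 1 → ∀ i j → p i ≡ true → p j ≡ true → i ≡ j
countF-unique {suc n} h zero    zero    pi pj = refl
countF-unique {suc n} h (suc i) zero    pi pj rewrite pj =
  contradiction (countF-pos i pi) (<⇒≱ h)
countF-unique {suc n} h zero    (suc j) pi pj rewrite pi =
  contradiction (countF-pos j pj) (<⇒≱ h)
countF-unique {suc n} {p} h (suc i) (suc j) pi pj =
  cong suc (countF-unique (≤-trans (m≤n+m _ ⟦ p zero ⟧) h) i j pi pj)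

-- Degrees and domination

IsSymmetric : ∀ {n} → Adj n → Set
IsSymmetric {n} P = ∀ i j → P i j ≡ P j i

-- `edgeCount` keeps only the increasing orientation of an edge. Each entry splits as
-- `up i j + up j i`, and exchanging the summations makes both halves equal to `edgeCount P`.
handshake : ∀ {n} (P : Adj n) → IsSymmetric P → (∀ i → P i i ≡ false) →
  sumF (degree P) ≡ 2 * edgeCount P
handshake P sym-P irr = begin
  sumF (degree P)
    ≡⟨ sumF-cong (λ i → trans (countF≡sumF (P i)) (trans (sumF-cong (split i)) (sumF-+ (up i) (λ j → up j i)))) ⟩
  sumF (λ i → sumF (up i) + sumF (λ j → up j i))
    ≡⟨ sumF-+ (λ i → sumF (up i)) (λ i → sumF (λ j → up j i)) ⟩
  sumF (λ i → sumF (up i)) + sumF (λ i → sumF (λ j → up j i))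
    ≡⟨ cong (sumF (λ i → sumF (up i)) +_) (sumF-swap (λ i j → up j i)) ⟩
  sumF (λ i → sumF (up i)) + sumF (λ i → sumF (up i))
    ≡⟨ cong (λ s → s + s) (sumF-cong (λ i → sym (countF≡sumF (λ j → P i j ∧ (toℕ i <ᵇ toℕ j))))) ⟩
  edgeCount P + edgeCount P
    ≡⟨ cong (edgeCount P +_) (sym (+-identityʳ (edgeCount P))) ⟩
  2 * edgeCount P ∎
  where
  open ≡-Reasoning
  up : ∀ i j → ℕ
  up i j = ⟦ P i j ∧ (toℕ i <ᵇ toℕ j) ⟧
  <ᵇ-true : ∀ {a b} → a < b → (a <ᵇ b) ≡ true
  <ᵇ-true {a} {b} a<b with a <ᵇ b in eq
  ... | true  = refl
  ... | false = ⊥-elim (subst T eq (<⇒<ᵇ a<b))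
  <ᵇ-false : ∀ {a b} → b ≤ a → (a <ᵇ b) ≡ false
  <ᵇ-false {a} {b} b≤a = ¬true⇒false λ eq → <⇒≱ (<ᵇ⇒< a b (subst T (sym eq) _)) b≤a
  split : ∀ i j → ⟦ P i j ⟧ ≡ up i j + up j i
  split i j with <-cmp (toℕ i) (toℕ j)
  ... | tri< i<j _ _ rewrite sym-P j i | <ᵇ-true i<j | <ᵇ-false (<⇒≤ i<j) with P i j
  ...   | true  = refl
  ...   | false = refl
  split i j | tri> _ _ j<i rewrite sym-P j i | <ᵇ-true j<i | <ᵇ-false (<⇒≤ j<i) with P i j
  ...   | true  = refl
  ...   | false = refl
  split i j | tri≈ _ i≡j _ with refl ← toℕ-injective i≡j rewrite irr i = refl

dominates-sym : ∀ {n} {x y u v : Fin n} → Dominates x y u v → Dominates x y v u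
dominates-sym (inj₁ (inj₁ h)) = inj₁ (inj₂ h)
dominates-sym (inj₁ (inj₂ h)) = inj₁ (inj₁ h)
dominates-sym (inj₂ (inj₁ h)) = inj₂ (inj₂ h)
dominates-sym (inj₂ (inj₂ h)) = inj₂ (inj₁ h)

module _ {n} {P : Adj n} (sym-P : IsSymmetric P) where

  dominated-sym : ∀ {u v} → DominatedExactlyOnce P u v → DominatedExactlyOnce P v u
  dominated-sym (x , y , Pxy , dom , only) =
    x , y , Pxy , dominates-sym dom , λ x′ y′ P′ dom′ → only x′ y′ P′ (dominates-sym dom′)

  private
    -- For distinct u and v, the edges of P dominating uv number `degree P u + degree P v`, less one
    -- if uv itself is in P, as it is then counted at both ends. The correction stands on the right
    -- to avoid subtraction.
    DegreeSum : Fin n → Fin n → Set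
    DegreeSum u v = degree P u + degree P v ≡ 1 + ⟦ P u v ⟧

    degreeSum-sym : ∀ {u v} → DegreeSum u v → DegreeSum v u
    degreeSum-sym {u} {v} h =
      trans (+-comm (degree P v) (degree P u)) (trans h (cong (λ b → 1 + ⟦ b ⟧) (sym-P u v)))

    -- The unique dominating edge, oriented so that it starts at u.
    dominated-from : ∀ {u v} → u ≢ v → ∀ y → P u y ≡ true →
      (∀ x′ y′ → P x′ y′ ≡ true → Dominates x′ y′ u v → SameEdge u y x′ y′) → DegreeSum u v
    dominated-from {u} {v} u≢v y Puy only with y ≟ v
    ... | yes refl = begin
      degree P u + degree P y ≡⟨ cong₂ _+_ (countF-single y at-u) (countF-single u at-y) ⟩
      ⟦ P u y ⟧ + ⟦ P y u ⟧   ≡⟨ cong (⟦ P u y ⟧ +_) (cong ⟦_⟧ (trans (sym-P y u) Puy)) ⟩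
      ⟦ P u y ⟧ + 1           ≡⟨ +-comm ⟦ P u y ⟧ 1 ⟩
      1 + ⟦ P u y ⟧           ∎
      where
      open ≡-Reasoning
      at-u : ∀ j → P u j ≡ true → j ≡ y
      at-u j Puj with only u j Puj (inj₁ (inj₁ refl))
      ... | inj₁ (_ , y≡j)   = sym y≡j
      ... | inj₂ (_ , y≡u) = contradiction (sym y≡u) u≢v
      at-y : ∀ j → P y j ≡ true → j ≡ u
      at-y j Pyj with only y j Pyj (inj₁ (inj₂ refl))
      ... | inj₁ (u≡y , _) = contradiction u≡y u≢v
      ... | inj₂ (u≡j , _) = sym u≡j
    ... | no y≢v = begin
      -- Row v has no true entry, so `countF-single` applies at any index; choosing u produces the
      -- term `⟦ P v u ⟧` wanted on the right.
      degree P u + degree P v ≡⟨ cong₂ _+_ (countF-single y at-u) (countF-single u (λ j Pvj → ⊥-elim (at-v j Pvj))) ⟩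
      ⟦ P u y ⟧ + ⟦ P v u ⟧   ≡⟨ cong₂ _+_ (cong ⟦_⟧ Puy) (cong ⟦_⟧ (sym-P v u)) ⟩
      1 + ⟦ P u v ⟧           ∎
      where
      open ≡-Reasoning
      at-u : ∀ j → P u j ≡ true → j ≡ y
      at-u j Puj with only u j Puj (inj₁ (inj₁ refl))
      ... | inj₁ (_ , y≡j)     = sym y≡j
      ... | inj₂ (u≡j , y≡u) = trans (sym u≡j) (sym y≡u)
      at-v : ∀ j → ¬ (P v j ≡ true)
      at-v j Pvj with only v j Pvj (inj₁ (inj₂ refl))
      ... | inj₁ (u≡v , _) = u≢v u≡v
      ... | inj₂ (_ , y≡v) = y≢v y≡v

    dominated-at-start : ∀ {u v x y} → u ≢ v → P x y ≡ true → x ≡ u ⊎ x ≡ v →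
      (∀ x′ y′ → P x′ y′ ≡ true → Dominates x′ y′ u v → SameEdge x y x′ y′) → DegreeSum u v
    dominated-at-start u≢v Pxy (inj₁ refl) only = dominated-from u≢v _ Pxy only
    dominated-at-start u≢v Pxy (inj₂ refl) only =
      degreeSum-sym (dominated-from (u≢v ∘ sym) _ Pxy (λ x′ y′ P′ → only x′ y′ P′ ∘ dominates-sym))

  dominated⇒degrees : ∀ {u v} → u ≢ v → DominatedExactlyOnce P u v → DegreeSum u v
  dominated⇒degrees u≢v (x , y , Pxy , inj₁ dom , only) = dominated-at-start u≢v Pxy dom only
  dominated⇒degrees u≢v (x , y , Pxy , inj₂ dom , only) =
    dominated-at-start u≢v (trans (sym-P y x) Pxy) dom (λ x′ y′ P′ → swap-ends ∘ only x′ y′ P′)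
    where
    swap-ends : ∀ {x y u v : Fin n} → SameEdge x y u v → SameEdge y x u v
    swap-ends (inj₁ (a , b)) = inj₂ (b , a)
    swap-ends (inj₂ (a , b)) = inj₁ (b , a)

  private
    dominating : ∀ {u v y} → P u y ≡ true →
      (∀ j → P u j ≡ true → SameEdge u y u j) → (∀ j → P v j ≡ true → SameEdge u y v j) →
      DominatedExactlyOnce P u v
    dominating {u} {v} {y} Puy at-u at-v = u , y , Puy , inj₁ (inj₁ refl) , only
      where
      reorient : ∀ {a b c d : Fin n} → SameEdge a b c d → SameEdge a b d c
      reorient (inj₁ h) = inj₂ h
      reorient (inj₂ h) = inj₁ h
      only : ∀ x′ y′ → P x′ y′ ≡ true → Dominates x′ y′ u v → SameEdge u y x′ y′
      only x′ y′ P′ (inj₁ (inj₁ refl)) = at-u y′ P′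
      only x′ y′ P′ (inj₁ (inj₂ refl)) = at-v y′ P′
      only x′ y′ P′ (inj₂ (inj₁ refl)) = reorient (at-u x′ (trans (sym-P y′ x′) P′))
      only x′ y′ P′ (inj₂ (inj₂ refl)) = reorient (at-v x′ (trans (sym-P y′ x′) P′))

    dominating-one-sided : ∀ {u v} → degree P u ≡ 1 → degree P v ≡ 0 → DominatedExactlyOnce P u v
    dominating-one-sided {u} {v} du dv with y , Puy ← countF-witness (≤-reflexive (sym du)) =
      dominating Puy (λ j Puj → inj₁ (refl , countF-unique (≤-reflexive du) y j Puy Puj))
        (λ j Pvj → true≢false Pvj (countF-none dv j))

  -- If uv is in P, both degrees are positive with sum 2, so uv is the only edge of P at either end.
  -- Otherwise one degree is 1 and the other 0, and the single edge at the former end is the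
  -- witness.
  degrees⇒dominated : ∀ {u v} → DegreeSum u v → DominatedExactlyOnce P u v
  degrees⇒dominated {u} {v} h with P u v in Puv
  ... | true = dominating Puv
    (λ j Puj → inj₁ (refl , countF-unique du v j Puv Puj))
    (λ j Pvj → inj₂ (countF-unique dv u j Pvu Pvj , refl))
    where
    Pvu = trans (sym-P v u) Puv
    du : degree P u ≤ 1
    du = +-cancelʳ-≤ 1 _ _ (≤-trans (+-monoʳ-≤ (degree P u) (countF-pos u Pvu)) (≤-reflexive h))
    dv : degree P v ≤ 1
    dv = +-cancelˡ-≤ 1 _ _ (≤-trans (+-monoˡ-≤ (degree P v) (countF-pos v Puv)) (≤-reflexive h))
  ... | false with degree P u in du | degree P v in dv
  ...   | 1 | 0 = dominating-one-sided du dv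
  ...   | 0 | 1 = dominated-sym (dominating-one-sided dv du)
  ...   | suc (suc _) | _ = contradiction h (λ ())
  ...   | 1 | suc _ = contradiction h (λ ())
  ...   | 0 | suc (suc _) = contradiction h (λ ())

-- Efficiency of small perfect edge dominating sets in cubic graphs

simple⇒≢ : ∀ {n} {adj : Adj n} → IsSimpleGraph adj → ∀ {v w} → adj v w ≡ true → v ≢ w
simple⇒≢ (_ , irr) {v} avw refl = true≢false avw (irr v)

module CubicGraph {n} {adj : Adj n} (simple : IsSimpleGraph adj) (cubic : IsCubic adj) where

  module _ {R : Adj n} (edges : IsEdgeSet adj R) where

    private
      sym-R = proj₁ edges
      R⊆adj = proj₂ edges
      r = degree R

      -- Each edge vw is dominated r v + r w − [vw ∈ R] times, and at least once
      -- if R is perfect; here the subtracted term has been moved to the other side.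
      demand supply : Fin n → Fin n → ℕ
      demand v w = ⟦ adj v w ⟧ + ⟦ R v w ⟧
      supply v w = ⟦ adj v w ⟧ * r v + ⟦ adj v w ⟧ * r w

      -- The sums run over ordered pairs, so each edge counts twice: `n * 3` is twice the number of
      -- edges of G, and `sumF r` is twice the size of R.
      Σdemand : sumF (λ v → sumF (demand v)) ≡ n * 3 + sumF r
      Σdemand = begin
        sumF (λ v → sumF (demand v))
          ≡⟨ sumF-cong (λ v → trans (sumF-+ (λ w → ⟦ adj v w ⟧) (λ w → ⟦ R v w ⟧))
               (sym (cong₂ _+_ (countF≡sumF (adj v)) (countF≡sumF (R v))))) ⟩
        sumF (λ v → degree adj v + r v)      ≡⟨ sumF-+ (degree adj) r ⟩
        sumF (degree adj) + sumF r           ≡⟨ cong (_+ sumF r) (trans (sumF-cong cubic) (sumF-const n 3)) ⟩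
        n * 3 + sumF r ∎
        where open ≡-Reasoning

      Σhalf : sumF (λ v → sumF (λ w → ⟦ adj v w ⟧ * r v)) ≡ 3 * sumF r
      Σhalf = trans (sumF-cong row) (sumF-*ˡ 3 r)
        where
        open ≡-Reasoning
        row : ∀ v → sumF (λ w → ⟦ adj v w ⟧ * r v) ≡ 3 * r v
        row v = begin
          sumF (λ w → ⟦ adj v w ⟧ * r v) ≡⟨ sumF-cong (λ w → *-comm ⟦ adj v w ⟧ (r v)) ⟩
          sumF (λ w → r v * ⟦ adj v w ⟧) ≡⟨ sumF-*ˡ (r v) (λ w → ⟦ adj v w ⟧) ⟩
          r v * sumF (λ w → ⟦ adj v w ⟧) ≡⟨ cong (r v *_) (trans (sym (countF≡sumF (adj v))) (cubic v)) ⟩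
          r v * 3                        ≡⟨ *-comm (r v) 3 ⟩
          3 * r v                        ∎

      Σsupply : sumF (λ v → sumF (supply v)) ≡ 3 * sumF r + 3 * sumF r
      Σsupply = begin
        sumF (λ v → sumF (supply v))
          ≡⟨ sumF-cong (λ v → sumF-+ (λ w → ⟦ adj v w ⟧ * r v) (λ w → ⟦ adj v w ⟧ * r w)) ⟩
        sumF (λ v → sumF (λ w → ⟦ adj v w ⟧ * r v) + sumF (λ w → ⟦ adj v w ⟧ * r w))
          ≡⟨ sumF-+ (λ v → sumF (λ w → ⟦ adj v w ⟧ * r v)) (λ v → sumF (λ w → ⟦ adj v w ⟧ * r w)) ⟩
        sumF (λ v → sumF (λ w → ⟦ adj v w ⟧ * r v)) + sumF (λ v → sumF (λ w → ⟦ adj v w ⟧ * r w))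
          ≡⟨ cong₂ _+_ Σhalf (trans (sumF-swap (λ v w → ⟦ adj v w ⟧ * r w))
               (trans (sumF-cong (λ w → sumF-cong (λ v → cong (λ b → ⟦ b ⟧ * r w) (proj₁ simple v w)))) Σhalf)) ⟩
        3 * sumF r + 3 * sumF r ∎
        where open ≡-Reasoning

      -- For an edge in R the demand is 2, met because both ends have positive degree in R. For an
      -- edge outside R perfection gives equality.
      demand≤supply : (∀ v w → adj v w ≡ true → R v w ≡ false → r v + r w ≡ 1) →
        ∀ v w → demand v w ≤ supply v w
      demand≤supply perfect v w with adj v w in avw | R v w in Rvw
      ... | false | true  = true≢false (R⊆adj v w Rvw) avw
      ... | false | false = z≤n
      ... | true  | true  = +-mono-≤
        (≤-trans (countF-pos w Rvw) (≤-reflexive (sym (*-identityˡ (r v)))))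
        (≤-trans (countF-pos v (trans (sym-R w v) Rvw)) (≤-reflexive (sym (*-identityˡ (r w)))))
      ... | true  | false = ≤-reflexive (sym (trans (cong₂ _+_ (*-identityˡ (r v)) (*-identityˡ (r w))) (perfect v w avw Rvw)))

    small-perfect⇒efficient :
      (∀ v w → adj v w ≡ true → R v w ≡ false → r v + r w ≡ 1) →
      5 * sumF r ≤ 3 * n → IsEfficientEDS adj R
    small-perfect⇒efficient perfect small = edges , λ v w avw →
      degrees⇒dominated sym-R (sym (begin
        1 + ⟦ R v w ⟧           ≡⟨ cong (λ b → ⟦ b ⟧ + ⟦ R v w ⟧) (sym avw) ⟩
        demand v w              ≡⟨ tight v w ⟩
        supply v w              ≡⟨ cong (λ b → ⟦ b ⟧ * r v + ⟦ b ⟧ * r w) avw ⟩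
        1 * r v + 1 * r w       ≡⟨ cong₂ _+_ (*-identityˡ (r v)) (*-identityˡ (r w)) ⟩
        r v + r w               ∎))
      where
      open ≡-Reasoning
      bound = demand≤supply perfect
      regroup : ∀ s → 3 * s + 3 * s ≡ 5 * s + s
      regroup = solve-∀
      Σsupply≤Σdemand : sumF (λ v → sumF (supply v)) ≤ sumF (λ v → sumF (demand v))
      Σsupply≤Σdemand = ≤-trans (≤-reflexive (trans Σsupply (regroup (sumF r))))
        (≤-trans (+-monoˡ-≤ (sumF r) small)
          (≤-reflexive (trans (cong (_+ sumF r) (*-comm 3 n)) (sym Σdemand))))
      -- Rigidity is used twice: first on the row sums, then within each row.
      tight : ∀ v w → demand v w ≡ supply v w
      tight v = sumF-rigid (bound v)
        (≤-reflexive (sym (sumF-rigid (λ u → sumF-mono-≤ (bound u)) Σsupply≤Σdemand v)))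

    efficient-size :
      (∀ v w → adj v w ≡ true → r v + r w ≡ 1 + ⟦ R v w ⟧) → 5 * sumF r ≡ 3 * n
    efficient-size efficient = +-cancelʳ-≡ (sumF r) _ _ (begin
      5 * sumF r + sumF r          ≡⟨ regroup (sumF r) ⟩
      3 * sumF r + 3 * sumF r      ≡⟨ sym Σsupply ⟩
      sumF (λ v → sumF (supply v)) ≡⟨ sumF-cong (λ v → sumF-cong (balance v)) ⟩
      sumF (λ v → sumF (demand v)) ≡⟨ Σdemand ⟩
      n * 3 + sumF r               ≡⟨ cong (_+ sumF r) (*-comm n 3) ⟩
      3 * n + sumF r               ∎)
      where
      open ≡-Reasoning
      regroup : ∀ s → 5 * s + s ≡ 3 * s + 3 * s
      regroup = solve-∀
      balance : ∀ v w → supply v w ≡ demand v w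
      balance v w with adj v w in avw
      ... | true  = trans (cong₂ _+_ (*-identityˡ (r v)) (*-identityˡ (r w))) (efficient v w avw)
      ... | false = cong ⟦_⟧ (sym (¬true⇒false λ Rvw → true≢false (R⊆adj v w Rvw) avw))

-- Perfect edge dominating sets of a single shield

localDegree : Adj 12 → (Fin 3 → Bool) → Fin 12 → ℕ
localDegree S e a = countF (S a) + sumF (λ c → ⟦ ⌊ a ≟ contact c ⌋ ∧ e c ⟧)

-- Here `e c` records whether the edge leaving the shield at `contact c` is chosen. `ContactsAgree`
-- lets the domination condition on an unchosen outer edge be read as the condition on the
-- corresponding edge of G.
InternallyPerfect ContactsAgree : Adj 12 → (Fin 3 → Bool) → Set
InternallyPerfect S e = ∀ a b → shieldAdj a b ≡ true → S a b ≡ false → localDegree S e a + localDegree S e b ≡ 1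
ContactsAgree S e = ∀ c → e c ≡ false → localDegree S e (contact c) ≡ sumF (λ c → ⟦ e c ⟧)

∀Bool? : {P : Bool → Set} → (∀ b → Dec (P b)) → Dec (∀ b → P b)
∀Bool? P? = map′ (λ { (t , f) true → t ; (t , f) false → f }) (λ h → h true , h false) (P? true ×-dec P? false)

-- The edges at the triangle v₄ₖ₊₂ v₄ₖ₊₃ v₄ₖ₊₄: its sides x = v₄ₖ₊₂v₄ₖ₊₃, y = v₄ₖ₊₃v₄ₖ₊₄,
-- z = v₄ₖ₊₂v₄ₖ₊₄, the edges p, q to v₄ₖ₊₁ and v₄ₖ₊₅, and the edge e leaving the shield.
record Block : Set where
  constructor block
  field p x y z q e : Bool

open Block

∀Block? : {P : Block → Set} → (∀ b → Dec (P b)) → Dec (∀ b → P b)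
∀Block? P? = map′ (λ h b → h (p b) (x b) (y b) (z b) (q b) (e b)) (λ h p x y z q e → h (block p x y z q e))
  (∀Bool? λ p → ∀Bool? λ x → ∀Bool? λ y → ∀Bool? λ z → ∀Bool? λ q → ∀Bool? λ e → P? (block p x y z q e))

-- Shaped so that they are the normal forms of localDegree at the vertices in question.
d₂ d₃ d₄ : Block → ℕ
d₂ b = ⟦ p b ⟧ + (⟦ x b ⟧ + (⟦ z b ⟧ + 0)) + 0
d₃ b = ⟦ x b ⟧ + (⟦ y b ⟧ + 0) + (⟦ e b ⟧ + 0)
d₄ b = ⟦ z b ⟧ + (⟦ y b ⟧ + (⟦ q b ⟧ + 0)) + 0

-- The degree of v₁, v₅ or v₉, whose only two edges join it to the neighbouring triangles.
link : Bool → Bool → ℕ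
link s t = ⟦ s ⟧ + (⟦ t ⟧ + 0) + 0

_false⇒_ : Bool → Set → Set
s false⇒ A = s ≡ false → A

-- The last condition is what one shield sees of an unchosen outer edge: the degrees of its two ends
-- sum to 1, so the degree at this contact is at most 1.
Inner : Block → Set
Inner b = (x b false⇒ (d₂ b + d₃ b ≡ 1)) × (y b false⇒ (d₃ b + d₄ b ≡ 1)) ×
  (z b false⇒ (d₂ b + d₄ b ≡ 1)) × (e b false⇒ (d₃ b ≤ 1))

Linked : Block → ℕ → Block → Set
Linked b ℓ b′ = (q b false⇒ (d₄ b + ℓ ≡ 1)) × (p b′ false⇒ (ℓ + d₂ b′ ≡ 1))

ext : Block → Block → Block → ℕ
ext b₀ b₁ b₂ = ⟦ e b₀ ⟧ + (⟦ e b₁ ⟧ + (⟦ e b₂ ⟧ + 0))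

ContactDegree : Block → ℕ → Set
ContactDegree b r = e b false⇒ (d₃ b ≡ r)

false⇒? : ∀ s {A} → Dec A → Dec (s false⇒ A)
false⇒? s A? = (s Bool.≟ false) →-dec A?

inner? : ∀ b → Dec (Inner b)
inner? b = false⇒? (x b) (d₂ b + d₃ b ℕ.≟ 1) ×-dec false⇒? (y b) (d₃ b + d₄ b ℕ.≟ 1) ×-dec
  false⇒? (z b) (d₂ b + d₄ b ℕ.≟ 1) ×-dec false⇒? (e b) (d₃ b ≤? 1)

linked? : ∀ b ℓ b′ → Dec (Linked b ℓ b′)
linked? b ℓ b′ = false⇒? (q b) (d₄ b + ℓ ℕ.≟ 1) ×-dec false⇒? (p b′) (ℓ + d₂ b′ ℕ.≟ 1)

-- Ordered and nested as the normal form of the degree sum over v₁, ..., v₁₂, so that the result of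
-- the search applies to that sum directly.
total : Block → Block → Block → ℕ
total b₀ b₁ b₂ =
  link (p b₀) (q b₂) + (d₂ b₀ + (d₃ b₀ + (d₄ b₀ +
  (link (q b₀) (p b₁) + (d₂ b₁ + (d₃ b₁ + (d₄ b₁ +
  (link (q b₁) (p b₂) + (d₂ b₂ + (d₃ b₂ + (d₄ b₂ + 0)))))))))))

Conclusion : Block → Block → Block → Set
Conclusion b₀ b₁ b₂ =
  (ContactDegree b₀ r × ContactDegree b₁ r × ContactDegree b₂ r) × total b₀ b₁ b₂ ≡ 6 + 9 * r
  where r = ext b₀ b₁ b₂

conclusion? : ∀ b₀ b₁ b₂ → Dec (Conclusion b₀ b₁ b₂)
conclusion? b₀ b₁ b₂ =
  (false⇒? (e b₀) (d₃ b₀ ℕ.≟ r) ×-dec false⇒? (e b₁) (d₃ b₁ ℕ.≟ r) ×-dec false⇒? (e b₂) (d₃ b₂ ℕ.≟ r))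
  ×-dec total b₀ b₁ b₂ ℕ.≟ 6 + 9 * r
  where r = ext b₀ b₁ b₂

-- By exhaustive search; stating Inner b before the next block is introduced prunes it.
three-blocks : ∀ b₀ → Inner b₀ → ∀ b₁ → Inner b₁ → ∀ b₂ → Inner b₂ →
  Linked b₀ (link (q b₀) (p b₁)) b₁ → Linked b₁ (link (q b₁) (p b₂)) b₂ →
  Linked b₂ (link (p b₀) (q b₂)) b₀ → Conclusion b₀ b₁ b₂
three-blocks = from-yes
  (∀Block? λ b₀ → inner? b₀ →-dec ∀Block? λ b₁ → inner? b₁ →-dec ∀Block? λ b₂ → inner? b₂ →-dec
    (linked? b₀ (link (q b₀) (p b₁)) b₁ →-dec linked? b₁ (link (q b₁) (p b₂)) b₂ →-dec
     linked? b₂ (link (p b₀) (q b₂)) b₀ →-dec conclusion? b₀ b₁ b₂))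

-- The conditions for S, together with the edges leaving the shield at the contacts c with e c,
-- to look like a perfect edge dominating set from inside the shield.
record LocallyPerfect (S : Adj 12) (e : Fin 3 → Bool) : Set where
  field
    symmetric : ∀ a b → S a b ≡ S b a
    within    : ∀ a b → S a b ≡ true → shieldAdj a b ≡ true
    internal  : InternallyPerfect S e
    external  : ∀ c → e c ≡ false → localDegree S e (contact c) ≤ 1

-- Reading every edge in its increasing orientation, and non-edges as absent, lets degrees compute
-- to expressions with one truth value per shield edge, as in `Block`.
upper : Adj 12 → Adj 12
upper S a b = shieldAdj a b ∧ (if toℕ a <ᵇ toℕ b then S a b else S b a)

module _ {S : Adj 12} {e : Fin 3 → Bool} (perf : LocallyPerfect S e) where
  open LocallyPerfect perf

  private
    S≗upper : ∀ a b → S a b ≡ upper S a b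
    S≗upper a b with shieldAdj a b in h
    ... | false = ¬true⇒false λ Sab → true≢false (within a b Sab) h
    ... | true with toℕ a <ᵇ toℕ b
    ...   | true  = refl
    ...   | false = symmetric a b

    10F 11F : Fin 12
    10F = suc 9F
    11F = suc (suc 9F)

    b₀ b₁ b₂ : Block
    b₀ = block (S 0F 1F) (S 1F 2F) (S 2F 3F) (S 1F 3F) (S 3F 4F) (e 0F)
    b₁ = block (S 4F 5F) (S 5F 6F) (S 6F 7F) (S 5F 7F) (S 7F 8F) (e 1F)
    -- The closing edge v₁₂v₁ is read as `S 0F 11F`, the orientation that `upper` keeps.
    b₂ = block (S 8F 9F) (S 9F 10F) (S 10F 11F) (S 9F 11F) (S 0F 11F) (e 2F)

    -- The neighbours of v₁₂ come in a different order than those of v₄ and v₈.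
    deg : Fin 12 → ℕ
    deg a = if ⌊ a ≟ 11F ⌋ then d₄ b₂ else localDegree (upper S) e a

    deg≗ : ∀ a → localDegree S e a ≡ deg a
    deg≗ a with a ≟ 11F | cong (_+ sumF (λ c → ⟦ ⌊ a ≟ contact c ⌋ ∧ e c ⟧)) (countF-cong (S≗upper a))
    ... | no  _    | eq = eq
    ... | yes refl | eq = trans eq (reorder ⟦ q b₂ ⟧ ⟦ z b₂ ⟧ ⟦ y b₂ ⟧)
      where
      reorder : ∀ i j k → i + (j + (k + 0)) + 0 ≡ j + (k + (i + 0)) + 0
      reorder = solve-∀

    at : ∀ a b → shieldAdj a b ≡ true → S a b ≡ false → deg a + deg b ≡ 1
    at a b h Sab = subst₂ (λ s t → s + t ≡ 1) (deg≗ a) (deg≗ b) (internal a b h Sab)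

    at-contact : ∀ c → e c ≡ false → deg (contact c) ≤ 1
    at-contact c ec = subst (_≤ 1) (deg≗ (contact c)) (external c ec)

    solved = three-blocks
      b₀ (at 1F 2F refl , at 2F 3F refl , at 1F 3F refl , at-contact 0F)
      b₁ (at 5F 6F refl , at 6F 7F refl , at 5F 7F refl , at-contact 1F)
      b₂ (at 9F 10F refl , at 10F 11F refl , at 9F 11F refl , at-contact 2F)
      (at 3F 4F refl , at 4F 5F refl)
      (at 7F 8F refl , at 8F 9F refl)
      ((λ h → at 11F 0F refl (trans (symmetric 11F 0F) h)) , at 0F 1F refl)

  contact-degree : ContactsAgree S e
  contact-degree c h = trans (deg≗ (contact c)) (by-block c h)
    where
    by-block : ∀ c → e c ≡ false → deg (contact c) ≡ sumF (λ c → ⟦ e c ⟧)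
    by-block 0F = proj₁ (proj₁ solved)
    by-block 1F = proj₁ (proj₂ (proj₁ solved))
    by-block 2F = proj₂ (proj₂ (proj₁ solved))

  degree-total : sumF (localDegree S e) ≡ 6 + 9 * sumF (λ c → ⟦ e c ⟧)
  degree-total = trans (sumF-cong deg≗) (proj₂ solved)

-- Canonical edge sets of a single shield

-- The perfect edge dominating set of a shield determined by the edges s, t, u leaving it
-- at v₃, v₇, v₁₁ (at most one of them), as a list of edges v_{i+1} v_{j+1}.
canonicalArcs : (s t u : Bool) → List (ℕ × ℕ × Bool)
canonicalArcs s t u = triangle 0 4 s t u ++ triangle 4 8 t u s ++ triangle 8 0 u s t
  where
  triangle : ℕ → ℕ → (own next previous : Bool) → List (ℕ × ℕ × Bool)
  -- A triangle whose own outer edge is chosen takes all five of its edges. If another triangle's is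
  -- chosen, it takes the side at its contact facing away from that triangle. If none is, it takes
  -- the side opposite its contact.
  triangle i j own next previous =
    (i , 1 + i , own) ∷ (1 + i , 2 + i , own ∨ next) ∷ (2 + i , 3 + i , own ∨ previous) ∷
    (1 + i , 3 + i , own ∨ not (next ∨ previous)) ∷ (3 + i , j , own) ∷ []

canonicalArc : (s t u : Bool) → Adj 12
canonicalArc s t u a b =
  any (λ { (i , j , present) → (toℕ a ≡ᵇ i) ∧ (toℕ b ≡ᵇ j) ∧ present }) (canonicalArcs s t u)

canonical : (s t u : Bool) → Adj 12
canonical s t u a b = shieldAdj a b ∧ (canonicalArc s t u a b ∨ canonicalArc s t u b a)

triple : (s t u : Bool) → Fin 3 → Bool
triple s t u 0F = s
triple s t u 1F = t
triple s t u 2F = u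

internallyPerfect? : ∀ S e → Dec (InternallyPerfect S e)
internallyPerfect? S e = all? λ a → all? λ b →
  (shieldAdj a b Bool.≟ true) →-dec (false⇒? (S a b) (localDegree S e a + localDegree S e b ℕ.≟ 1))

contactsAgree? : ∀ S e → Dec (ContactsAgree S e)
contactsAgree? S e = all? λ c → false⇒? (e c) (localDegree S e (contact c) ℕ.≟ sumF (λ c → ⟦ e c ⟧))

-- Checked by evaluation. The bound holds in the application because an efficient edge dominating
-- set is a matching.
canonical-perfect : ∀ s t u → sumF (λ c → ⟦ triple s t u c ⟧) ≤ 1 →
  InternallyPerfect (canonical s t u) (triple s t u) × ContactsAgree (canonical s t u) (triple s t u)
canonical-perfect = from-yes (∀Bool? λ s → ∀Bool? λ t → ∀Bool? λ u →
  (sumF (λ c → ⟦ triple s t u c ⟧) ≤? 1) →-dec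
  (internallyPerfect? (canonical s t u) (triple s t u) ×-dec contactsAgree? (canonical s t u) (triple s t u)))

shieldAdj-sym : IsSymmetric shieldAdj
shieldAdj-sym a b = Bool.∨-comm (shieldArc a b) (shieldArc b a)

canonical-sym : ∀ s t u → IsSymmetric (canonical s t u)
canonical-sym s t u a b = cong₂ _∧_ (shieldAdj-sym a b) (Bool.∨-comm (canonicalArc s t u a b) (canonicalArc s t u b a))

canonicalFor : (Fin 3 → Bool) → Adj 12
canonicalFor e = canonical (e 0F) (e 1F) (e 2F)

module _ (e : Fin 3 → Bool) (at-most-one : sumF (λ c → ⟦ e c ⟧) ≤ 1) where

  private
    perfect = canonical-perfect (e 0F) (e 1F) (e 2F) at-most-one

    -- The tabulated function equals `e` only pointwise, so the checked statements are carried over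
    -- degree by degree.
    triple≗ : ∀ c → triple (e 0F) (e 1F) (e 2F) c ≡ e c
    triple≗ 0F = refl
    triple≗ 1F = refl
    triple≗ 2F = refl

    degree-triple : ∀ a → localDegree (canonicalFor e) (triple (e 0F) (e 1F) (e 2F)) a ≡ localDegree (canonicalFor e) e a
    degree-triple a = cong (countF (canonicalFor e a) +_)
      (sumF-cong (λ c → cong (λ s → ⟦ ⌊ a ≟ contact c ⌋ ∧ s ⟧) (triple≗ c)))

  canonicalFor-internal : InternallyPerfect (canonicalFor e) e
  canonicalFor-internal a b h Sab =
    subst₂ (λ s t → s + t ≡ 1) (degree-triple a) (degree-triple b) (proj₁ perfect a b h Sab)

  canonicalFor-contacts : ContactsAgree (canonicalFor e) e
  canonicalFor-contacts c ec = trans (sym (degree-triple (contact c))) (proj₂ perfect c (trans (triple≗ c) ec))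

-- The magnification

module Magnification {n} {adj : Adj n} (simple : IsSimpleGraph adj) (cubic : IsCubic adj)
  (σ : Fin n → Fin n → Fin 3) (assignment : IsContactAssignment adj σ) where

  open CubicGraph simple cubic

  -- Neighbours indexed by contact vertices

  private
    countF-by-contact : ∀ v (p : Fin n → Bool) →
      countF p ≡ sumF (λ c → countF (λ w → p w ∧ ⌊ σ v w ≟ c ⌋))
    countF-by-contact v p = begin
      countF p                                           ≡⟨ countF≡sumF p ⟩
      sumF (λ w → ⟦ p w ⟧)                               ≡⟨ sumF-cong split ⟩
      sumF (λ w → sumF (λ c → ⟦ p w ∧ ⌊ σ v w ≟ c ⌋ ⟧))  ≡⟨ sumF-swap (λ w c → ⟦ p w ∧ ⌊ σ v w ≟ c ⌋ ⟧) ⟩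
      sumF (λ c → sumF (λ w → ⟦ p w ∧ ⌊ σ v w ≟ c ⌋ ⟧))  ≡⟨ sumF-cong (λ c → sym (countF≡sumF (λ w → p w ∧ ⌊ σ v w ≟ c ⌋))) ⟩
      sumF (λ c → countF (λ w → p w ∧ ⌊ σ v w ≟ c ⌋))    ∎
      where
      open ≡-Reasoning
      split : ∀ w → ⟦ p w ⟧ ≡ sumF (λ c → ⟦ p w ∧ ⌊ σ v w ≟ c ⌋ ⟧)
      split w = begin
        ⟦ p w ⟧                             ≡⟨ cong ⟦_⟧ (sym (Bool.∧-identityʳ (p w))) ⟩
        ⟦ p w ∧ true ⟧                      ≡⟨ cong (λ b → ⟦ p w ∧ b ⟧) (sym (⌊⌋-true (σ v w ≟ σ v w) refl)) ⟩
        ⟦ p w ∧ ⌊ σ v w ≟ σ v w ⌋ ⟧         ≡⟨ sym (sumF-single (σ v w) other) ⟩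
        sumF (λ c → ⟦ p w ∧ ⌊ σ v w ≟ c ⌋ ⟧) ∎
        where
        other : ∀ c → c ≢ σ v w → ⟦ p w ∧ ⌊ σ v w ≟ c ⌋ ⟧ ≡ 0
        other c c≢ = cong ⟦_⟧ (trans (cong (p w ∧_) (⌊⌋-false (σ v w ≟ c) (c≢ ∘ sym))) (Bool.∧-zeroʳ (p w)))

    -- Injectivity puts at most one neighbour at each contact. The three counts sum to the degree 3,
    -- so each is exactly 1, and `nb v` inverts `σ v` on neighbours.
    neighbour-at : ∀ v c → ∃ λ w → adj v w ∧ ⌊ σ v w ≟ c ⌋ ≡ true
    neighbour-at v c = countF-witness (≤-reflexive (sym
      (sumF-rigid at-most-one (≤-reflexive (trans (sym (cubic v)) (countF-by-contact v (adj v)))) c)))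
      where
      at-most-one : ∀ c → countF (λ w → adj v w ∧ ⌊ σ v w ≟ c ⌋) ≤ 1
      at-most-one c = countF-≤1 λ i j hi hj → assignment v i j (∧-trueˡ hi) (∧-trueˡ hj)
        (trans (⌊⌋-sound (σ v i ≟ c) (∧-trueʳ hi)) (sym (⌊⌋-sound (σ v j ≟ c) (∧-trueʳ hj))))

  nb : Fin n → Fin 3 → Fin n
  nb v c = proj₁ (neighbour-at v c)

  nb-adj : ∀ v c → adj v (nb v c) ≡ true
  nb-adj v c = ∧-trueˡ (proj₂ (neighbour-at v c))

  σ-nb : ∀ v c → σ v (nb v c) ≡ c
  σ-nb v c = ⌊⌋-sound (σ v (nb v c) ≟ c) (∧-trueʳ (proj₂ (neighbour-at v c)))

  nb-σ : ∀ {v w} → adj v w ≡ true → nb v (σ v w) ≡ w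
  nb-σ {v} {w} avw = assignment v _ w (nb-adj v (σ v w)) avw (σ-nb v (σ v w))

  countF-neighbours : ∀ v (p : Fin n → Bool) → (∀ w → p w ≡ true → adj v w ≡ true) →
    countF p ≡ sumF (λ c → ⟦ p (nb v c) ⟧)
  countF-neighbours v p p⊆adj = trans (countF-by-contact v p) (sumF-cong λ c → trans
    (countF-single (nb v c) λ w h → assignment v w (nb v c) (p⊆adj w (∧-trueˡ h)) (nb-adj v c)
      (trans (⌊⌋-sound (σ v w ≟ c) (∧-trueʳ h)) (sym (σ-nb v c))))
    (cong ⟦_⟧ (trans (cong (p (nb v c) ∧_) (⌊⌋-true (σ v (nb v c) ≟ c) (σ-nb v c)))
                 (Bool.∧-identityʳ (p (nb v c))))))

  -- Gluing shield edge sets along edges of G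

  gluePairs : (Fin n → Adj 12) → Adj n → Fin n × Fin 12 → Fin n × Fin 12 → Bool
  gluePairs S R (v , a) (w , b) =
    if ⌊ v ≟ w ⌋ then S v a b else (R v w ∧ ⌊ a ≟ contact (σ v w) ⌋ ∧ ⌊ b ≟ contact (σ w v) ⌋)

  -- The magnification itself is definitionally glue (λ _ → shieldAdj) adj.
  glue : (Fin n → Adj 12) → Adj n → Adj (n * 12)
  glue S R x y = gluePairs S R (remQuot {n} 12 x) (remQuot {n} 12 y)

  mag : Adj (n * 12)
  mag = magnification adj σ

  node : Fin n → Fin 12 → Fin (n * 12)
  node = combine {n} {12}

  node-elim₂ : {Q : Fin (n * 12) → Fin (n * 12) → Set} →
    (∀ v a w b → Q (node v a) (node w b)) → ∀ x y → Q x y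
  node-elim₂ {Q} h x y = subst₂ Q (combine-remQuot {n} 12 x) (combine-remQuot {n} 12 y) (h _ _ _ _)

  module _ (S : Fin n → Adj 12) (R : Adj n) where

    glue-node : ∀ v a w b → glue S R (node v a) (node w b) ≡ gluePairs S R (v , a) (w , b)
    glue-node v a w b = cong₂ (gluePairs S R) (remQuot-combine {n} {12} v a) (remQuot-combine {n} {12} w b)

    glue-inner : ∀ v a b → glue S R (node v a) (node v b) ≡ S v a b
    glue-inner v a b = trans (glue-node v a v b)
      (cong (if_then S v a b else _) (⌊⌋-true (v ≟ v) refl))

    glue-outer : ∀ {v w} → v ≢ w → ∀ a b →
      glue S R (node v a) (node w b) ≡ R v w ∧ ⌊ a ≟ contact (σ v w) ⌋ ∧ ⌊ b ≟ contact (σ w v) ⌋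
    glue-outer {v} {w} v≢w a b = trans (glue-node v a w b)
      (cong (if_then S v a b else _) (⌊⌋-false (v ≟ w) v≢w))

    glue-contact : ∀ {v w} → v ≢ w → glue S R (node v (contact (σ v w))) (node w (contact (σ w v))) ≡ R v w
    glue-contact {v} {w} v≢w = begin
      glue S R (node v (contact (σ v w))) (node w (contact (σ w v)))
        ≡⟨ glue-outer v≢w (contact (σ v w)) (contact (σ w v)) ⟩
      R v w ∧ ⌊ contact (σ v w) ≟ contact (σ v w) ⌋ ∧ ⌊ contact (σ w v) ≟ contact (σ w v) ⌋
        ≡⟨ cong₂ (λ s t → R v w ∧ s ∧ t) (⌊⌋-true (contact (σ v w) ≟ _) refl) (⌊⌋-true (contact (σ w v) ≟ _) refl) ⟩
      R v w ∧ true
        ≡⟨ Bool.∧-identityʳ (R v w) ⟩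
      R v w ∎
      where open ≡-Reasoning

  mag-inner : ∀ v a b → mag (node v a) (node v b) ≡ shieldAdj a b
  mag-inner = glue-inner (λ _ → shieldAdj) adj

  mag-contact : ∀ {v w} → adj v w ≡ true → mag (node v (contact (σ v w))) (node w (contact (σ w v))) ≡ true
  mag-contact avw = trans (glue-contact (λ _ → shieldAdj) adj (simple⇒≢ simple avw)) avw

  mag-outer : ∀ {v w} → v ≢ w → ∀ a b → mag (node v a) (node w b) ≡ true →
    adj v w ≡ true × a ≡ contact (σ v w) × b ≡ contact (σ w v)
  mag-outer {v} {w} v≢w a b h with h′ ← trans (sym (glue-outer (λ _ → shieldAdj) adj v≢w a b)) h =
    ∧-trueˡ h′ , ⌊⌋-sound (a ≟ _) (∧-trueˡ (∧-trueʳ {adj v w} h′)) ,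
    ⌊⌋-sound (b ≟ _) (∧-trueʳ {⌊ a ≟ contact (σ v w) ⌋} (∧-trueʳ {adj v w} h′))

  mag-irrefl : ∀ x → mag x x ≡ false
  mag-irrefl x = subst (λ y → mag y y ≡ false) (combine-remQuot {n} 12 x)
    (at-node (remQuot {n} 12 x))
    where
    shieldAdj-irrefl : ∀ a → shieldAdj a a ≡ false
    shieldAdj-irrefl = from-yes (all? λ a → shieldAdj a a Bool.≟ false)
    at-node : ∀ va → mag (node (proj₁ va) (proj₂ va)) (node (proj₁ va) (proj₂ va)) ≡ false
    at-node (v , a) = trans (mag-inner v a a) (shieldAdj-irrefl a)

  edge-sym : IsSymmetric adj
  edge-sym = proj₁ simple

  -- Contracting an edge set of the magnification

  module EdgeSet {P : Adj (n * 12)} (edges : IsEdgeSet mag P) where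

    private
      sym-P = proj₁ edges
      P⊆mag = proj₂ edges

    contracted : Adj n
    contracted v w = adj v w ∧ P (node v (contact (σ v w))) (node w (contact (σ w v)))

    contracted-edges : IsEdgeSet adj contracted
    contracted-edges = (λ v w → cong₂ _∧_ (edge-sym v w) (sym-P _ _)) , λ v w → ∧-trueˡ

    inside : Fin n → Adj 12
    inside v a b = P (node v a) (node v b)

    leaving : Fin n → Fin 3 → Bool
    leaving v c = contracted v (nb v c)

    contracted-degree : ∀ v → degree contracted v ≡ sumF (λ c → ⟦ leaving v c ⟧)
    contracted-degree v = countF-neighbours v (contracted v) (λ w → ∧-trueˡ)

    -- The row of the vertex is cut into one block per shield. Its own block gives the inner degree;
    -- another block has at most one true entry, at the contact assigned to v. The outer
    -- contributions are then reindexed by contacts.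
    node-degree : ∀ v a → degree P (node v a) ≡ localDegree (inside v) (leaving v) a
    node-degree v a = begin
      degree P (node v a)
        ≡⟨ trans (countF≡sumF (P (node v a))) (sumF-combine n (λ y → ⟦ P (node v a) y ⟧)) ⟩
      sumF (λ w → sumF (λ b → ⟦ P (node v a) (node w b) ⟧))
        ≡⟨ sumF-cong (λ w → trans (sym (countF≡sumF (λ b → P (node v a) (node w b)))) (towards w)) ⟩
      sumF (λ w → (if ⌊ v ≟ w ⌋ then countF (inside v a) else 0) + ⟦ out w ⟧)
        ≡⟨ sumF-+ (λ w → if ⌊ v ≟ w ⌋ then countF (inside v a) else 0) (λ w → ⟦ out w ⟧) ⟩
      sumF (λ w → if ⌊ v ≟ w ⌋ then countF (inside v a) else 0) + sumF (λ w → ⟦ out w ⟧)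
        ≡⟨ cong₂ _+_ own (trans (sym (countF≡sumF out)) (countF-neighbours v out (λ w h → ∧-trueˡ (∧-trueʳ {⌊ a ≟ contact (σ v w) ⌋} h)))) ⟩
      countF (inside v a) + sumF (λ c → ⟦ out (nb v c) ⟧)
        ≡⟨ cong (countF (inside v a) +_) (sumF-cong (λ c → cong (λ d → ⟦ ⌊ a ≟ contact d ⌋ ∧ leaving v c ⟧) (σ-nb v c))) ⟩
      localDegree (inside v) (leaving v) a ∎
      where
      open ≡-Reasoning
      out : Fin n → Bool
      out w = ⌊ a ≟ contact (σ v w) ⌋ ∧ contracted v w

      own : sumF (λ w → if ⌊ v ≟ w ⌋ then countF (inside v a) else 0) ≡ countF (inside v a)
      own = trans
        (sumF-single v (λ w w≢v → cong (λ b → if b then countF (inside v a) else 0) (⌊⌋-false (v ≟ w) (w≢v ∘ sym))))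
        (cong (λ b → if b then countF (inside v a) else 0) (⌊⌋-true (v ≟ v) refl))

      towards : ∀ w → countF (λ b → P (node v a) (node w b)) ≡
        (if ⌊ v ≟ w ⌋ then countF (inside v a) else 0) + ⟦ out w ⟧
      towards w with v ≟ w
      -- G has no loops, so `out v` contributes nothing to the shield's own block.
      ... | yes refl = sym (trans (cong (λ b → countF (inside v a) + ⟦ b ⟧)
          (trans (cong (λ s → ⌊ a ≟ contact (σ v v) ⌋ ∧ s ∧ P (node v (contact (σ v v))) (node v (contact (σ v v)))) (proj₂ simple v)) (Bool.∧-zeroʳ ⌊ a ≟ contact (σ v v) ⌋)))
          (+-identityʳ _))
      ... | no v≢w = trans
        (countF-single (contact (σ w v)) (λ b h → proj₂ (proj₂ (mag-outer v≢w a b (P⊆mag _ _ h)))))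
        (cong ⟦_⟧ only-contact)
        where
        only-contact : P (node v a) (node w (contact (σ w v))) ≡ out w
        only-contact with a ≟ contact (σ v w)
        ... | no a≢ = ¬true⇒false λ h → a≢ (proj₁ (proj₂ (mag-outer v≢w a _ (P⊆mag _ _ h))))
        ... | yes refl with adj v w in avw
        ...   | true  = refl
        ...   | false = ¬true⇒false λ h → true≢false (proj₁ (mag-outer v≢w _ _ (P⊆mag _ _ h))) avw

    module _ (perfect : ∀ x y → mag x y ≡ true → P x y ≡ false → degree P x + degree P y ≡ 1) where

      private
        across : ∀ {v w} → adj v w ≡ true → contracted v w ≡ false →
          localDegree (inside v) (leaving v) (contact (σ v w)) +
          localDegree (inside w) (leaving w) (contact (σ w v)) ≡ 1
        across {v} {w} avw Rvw = subst₂ (λ s t → s + t ≡ 1) (node-degree v _) (node-degree w _)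
          (perfect _ _ (mag-contact avw) (trans (cong (_∧ P _ _) (sym avw)) Rvw))

        local : ∀ v → LocallyPerfect (inside v) (leaving v)
        local v = record
          { symmetric = λ a b → sym-P _ _
          ; within    = λ a b h → trans (sym (mag-inner v a b)) (P⊆mag _ _ h)
          ; internal  = λ a b h Sab → subst₂ (λ s t → s + t ≡ 1) (node-degree v a) (node-degree v b)
              (perfect _ _ (trans (mag-inner v a b) h) Sab)
          ; external  = λ c h → subst (λ d → localDegree (inside v) (leaving v) (contact d) ≤ 1) (σ-nb v c)
              (≤-trans (m≤m+n _ _) (≤-reflexive (across (nb-adj v c) h)))
          }

        at-contact : ∀ {v w} → adj v w ≡ true → contracted v w ≡ false →
          localDegree (inside v) (leaving v) (contact (σ v w)) ≡ degree contracted v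
        at-contact {v} {w} avw Rvw = trans
          (contact-degree (local v) (σ v w) (trans (cong (contracted v) (nb-σ avw)) Rvw))
          (sym (contracted-degree v))

      -- The copy of vw is outside P, so the degrees at its two contacts sum to 1. By
      -- `contact-degree` these are the degrees of v and w in the contracted set.
      contracted-perfect : ∀ v w → adj v w ≡ true → contracted v w ≡ false →
        degree contracted v + degree contracted w ≡ 1
      contracted-perfect v w avw Rvw = trans
        (sym (cong₂ _+_ (at-contact avw Rvw)
          (at-contact (trans (edge-sym w v) avw) (trans (proj₁ contracted-edges w v) Rvw))))
        (across avw Rvw)

      -- This is |P| = 3n + 9|R| doubled. One direction of the theorem uses it to bound |R|, the
      -- other to compute |P|.
      magnified-size : 2 * edgeCount P ≡ n * 6 + 9 * sumF (degree contracted)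
      magnified-size = begin
        2 * edgeCount P
          ≡⟨ sym (handshake P sym-P (λ x → ¬true⇒false λ h → true≢false (P⊆mag x x h) (mag-irrefl x))) ⟩
        sumF (degree P)
          ≡⟨ sumF-combine n (degree P) ⟩
        sumF (λ v → sumF (λ a → degree P (node v a)))
          ≡⟨ sumF-cong (λ v → trans (sumF-cong (node-degree v)) (trans (degree-total (local v))
               (cong (λ s → 6 + 9 * s) (sym (contracted-degree v))))) ⟩
        sumF (λ v → 6 + 9 * degree contracted v)
          ≡⟨ trans (sumF-+ (λ _ → 6) (λ v → 9 * degree contracted v))
               (cong₂ _+_ (sumF-const n 6) (sumF-*ˡ 9 (degree contracted))) ⟩
        n * 6 + 9 * sumF (degree contracted) ∎
        where open ≡-Reasoning

  contract : Σ (Adj (n * 12)) (λ P → IsPerfectEDS mag P × 10 * edgeCount P ≤ 57 * n) → HasEfficientEDS adj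
  contract (P , (edges , dominated) , small) =
    contracted , small-perfect⇒efficient contracted-edges (contracted-perfect perfect) few
    where
    open EdgeSet edges
    perfect : ∀ x y → mag x y ≡ true → P x y ≡ false → degree P x + degree P y ≡ 1
    perfect x y h Pxy = trans
      (dominated⇒degrees (proj₁ edges) (λ { refl → true≢false h (mag-irrefl x) }) (dominated x y h Pxy))
      (cong (λ b → 1 + ⟦ b ⟧) Pxy)
    s = sumF (degree contracted)
    few : 5 * s ≤ 3 * n
    -- Twenty times |P| is 60n + 90s and is at most 114n = 60n + 54n; cancelling 60n and then 18
    -- leaves 5s ≤ 3n.
    few = *-cancelˡ-≤ 18 (+-cancelˡ-≤ (60 * n) (18 * (5 * s)) (18 * (3 * n)) (begin
      60 * n + 18 * (5 * s)      ≡⟨ regroup n s ⟩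
      10 * (n * 6 + 9 * s)       ≡⟨ cong (10 *_) (sym (magnified-size perfect)) ⟩
      10 * (2 * edgeCount P)     ≡⟨ swap (edgeCount P) ⟩
      2 * (10 * edgeCount P)     ≤⟨ *-monoʳ-≤ 2 small ⟩
      2 * (57 * n)               ≡⟨ regroup′ n ⟩
      60 * n + 18 * (3 * n)      ∎))
      where
      open ≤-Reasoning
      regroup : ∀ n s → 60 * n + 18 * (5 * s) ≡ 10 * (n * 6 + 9 * s)
      regroup = solve-∀
      swap : ∀ k → 10 * (2 * k) ≡ 2 * (10 * k)
      swap = solve-∀
      regroup′ : ∀ n → 2 * (57 * n) ≡ 60 * n + 18 * (3 * n)
      regroup′ = solve-∀

  -- Expanding an efficient edge dominating set of G

  module Expansion {R : Adj n} (edges : IsEdgeSet adj R)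
    (sums : ∀ v w → adj v w ≡ true → degree R v + degree R w ≡ 1 + ⟦ R v w ⟧)
    (S : Fin n → Adj 12) (sym-S : ∀ v → IsSymmetric (S v))
    (S⊆shield : ∀ v a b → S v a b ≡ true → shieldAdj a b ≡ true)
    (internal : ∀ v → InternallyPerfect (S v) (λ c → R v (nb v c)))
    (contacts : ∀ v → ContactsAgree (S v) (λ c → R v (nb v c))) where

    private
      sym-R = proj₁ edges
      R⊆adj = proj₂ edges

    P : Adj (n * 12)
    P = glue S R

    P-sym : IsSymmetric P
    P-sym = node-elim₂ symmetric
      where
      symmetric : ∀ v a w b → P (node v a) (node w b) ≡ P (node w b) (node v a)
      symmetric v a w b with v ≟ w
      ... | yes refl = trans (glue-inner S R v a b) (trans (sym-S v a b) (sym (glue-inner S R v b a)))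
      ... | no v≢w = trans (glue-outer S R v≢w a b) (trans
        (cong₂ _∧_ (sym-R v w) (Bool.∧-comm ⌊ a ≟ contact (σ v w) ⌋ ⌊ b ≟ contact (σ w v) ⌋))
        (sym (glue-outer S R (v≢w ∘ sym) b a)))

    P⊆mag : ∀ x y → P x y ≡ true → mag x y ≡ true
    P⊆mag = node-elim₂ within
      where
      within : ∀ v a w b → P (node v a) (node w b) ≡ true → mag (node v a) (node w b) ≡ true
      within v a w b h with v ≟ w
      ... | yes refl = trans (mag-inner v a b) (S⊆shield v a b (trans (sym (glue-inner S R v a b)) h))
      ... | no v≢w with h′ ← trans (sym (glue-outer S R v≢w a b)) h =
        trans (glue-outer (λ _ → shieldAdj) adj v≢w a b)
          (cong₂ _∧_ (R⊆adj v w (∧-trueˡ h′)) (∧-trueʳ {R v w} h′))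

    P-edges : IsEdgeSet mag P
    P-edges = P-sym , P⊆mag

    open EdgeSet P-edges

    -- Contraction undoes gluing, so the degree and size formulas for P become formulas in R.
    contracted≗R : ∀ v w → contracted v w ≡ R v w
    contracted≗R v w with adj v w in avw
    ... | true  = glue-contact S R (simple⇒≢ simple avw)
    ... | false = sym (¬true⇒false λ h → true≢false (R⊆adj v w h) avw)

    degree-P : ∀ v a → degree P (node v a) ≡ localDegree (S v) (λ c → R v (nb v c)) a
    degree-P v a = trans (node-degree v a) (cong₂ _+_ (countF-cong (glue-inner S R v a))
      (sumF-cong (λ c → cong (λ s → ⟦ ⌊ a ≟ contact c ⌋ ∧ s ⟧) (contracted≗R v (nb v c)))))

    at-contact : ∀ {v w} → adj v w ≡ true → R v w ≡ false →
      degree P (node v (contact (σ v w))) ≡ degree R v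
    at-contact {v} {w} avw Rvw = trans (degree-P v _) (trans
      (contacts v (σ v w) (trans (cong (R v) (nb-σ avw)) Rvw))
      (sym (countF-neighbours v (R v) (R⊆adj v))))

    -- Inside a shield this is `internal`. On an outer edge `contacts` replaces the contact degrees
    -- by degrees in R, which sum to 1 by efficiency.
    P-perfect : ∀ x y → mag x y ≡ true → P x y ≡ false → degree P x + degree P y ≡ 1
    P-perfect = node-elim₂ at
      where
      at : ∀ v a w b → mag (node v a) (node w b) ≡ true → P (node v a) (node w b) ≡ false →
        degree P (node v a) + degree P (node w b) ≡ 1
      at v a w b h Pab = case (v ≟ w)
        where
        case : Dec (v ≡ w) → degree P (node v a) + degree P (node w b) ≡ 1
        case (yes refl) = trans (cong₂ _+_ (degree-P v a) (degree-P v b))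
          (internal v a b (trans (sym (mag-inner v a b)) h) (trans (sym (glue-inner S R v a b)) Pab))
        case (no v≢w) with avw , refl , refl ← mag-outer v≢w a b h
          with Rvw ← trans (sym (glue-contact S R v≢w)) Pab =
          trans (cong₂ _+_ (at-contact avw Rvw) (at-contact (trans (edge-sym w v) avw) (trans (sym-R w v) Rvw)))
            (trans (sums v w avw) (cong (λ b → 1 + ⟦ b ⟧) Rvw))

    P-perfectEDS : IsPerfectEDS mag P
    P-perfectEDS = P-edges , λ x y h Pxy →
      degrees⇒dominated P-sym (trans (P-perfect x y h Pxy) (cong (λ b → 1 + ⟦ b ⟧) (sym Pxy)))

    -- Efficiency fixes 5|R| at 3n/2, so the bound of the theorem is attained exactly.
    P-size : 10 * edgeCount P ≡ 57 * n
    P-size = begin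
      10 * edgeCount P                              ≡⟨ halve (edgeCount P) ⟩
      5 * (2 * edgeCount P)                         ≡⟨ cong (5 *_) (magnified-size P-perfect) ⟩
      5 * (n * 6 + 9 * sumF (degree contracted))
        ≡⟨ cong (λ s → 5 * (n * 6 + 9 * s)) (sumF-cong (λ v → countF-cong (contracted≗R v))) ⟩
      5 * (n * 6 + 9 * sumF (degree R))             ≡⟨ regroup n (sumF (degree R)) ⟩
      30 * n + 9 * (5 * sumF (degree R))            ≡⟨ cong (λ s → 30 * n + 9 * s) (efficient-size edges sums) ⟩
      30 * n + 9 * (3 * n)                          ≡⟨ collect n ⟩
      57 * n                                        ∎
      where
      open ≡-Reasoning
      halve : ∀ k → 10 * k ≡ 5 * (2 * k)
      halve = solve-∀
      regroup : ∀ n s → 5 * (n * 6 + 9 * s) ≡ 30 * n + 9 * (5 * s)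
      regroup = solve-∀
      collect : ∀ n → 30 * n + 9 * (3 * n) ≡ 57 * n
      collect = solve-∀

  expand : HasEfficientEDS adj → Σ (Adj (n * 12)) (λ P → IsPerfectEDS mag P × 10 * edgeCount P ≤ 57 * n)
  expand (R , edges , dominated) = P , P-perfectEDS , ≤-reflexive P-size
    where
    sums : ∀ v w → adj v w ≡ true → degree R v + degree R w ≡ 1 + ⟦ R v w ⟧
    sums v w avw = dominated⇒degrees (proj₁ edges) (simple⇒≢ simple avw) (dominated v w avw)

    -- If vw is in R, its end degrees sum to 2 and that of w is positive. Hence at most one outer
    -- edge per shield is chosen, as the canonical sets require.
    degree≤1 : ∀ v → degree R v ≤ 1
    degree≤1 v with degree R v in dv
    ... | zero  = z≤n
    ... | suc k with w , Rvw ← countF-witness {p = R v} (≤-trans (s≤s z≤n) (≤-reflexive (sym dv))) =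
      +-cancelʳ-≤ 1 (suc k) 1 (begin
        suc k + 1               ≡⟨ cong (_+ 1) (sym dv) ⟩
        degree R v + 1          ≤⟨ +-monoʳ-≤ (degree R v) (countF-pos v (trans (proj₁ edges w v) Rvw)) ⟩
        degree R v + degree R w ≡⟨ sums v w (proj₂ edges v w Rvw) ⟩
        1 + ⟦ R v w ⟧           ≡⟨ cong (λ b → 1 + ⟦ b ⟧) Rvw ⟩
        2                       ∎)
      where open ≤-Reasoning

    leaving≤1 : ∀ v → sumF (λ c → ⟦ R v (nb v c) ⟧) ≤ 1
    leaving≤1 v = ≤-trans (≤-reflexive (sym (countF-neighbours v (R v) (proj₂ edges v)))) (degree≤1 v)

    open Expansion edges sums
      (λ v → canonicalFor (λ c → R v (nb v c)))
      (λ v → canonical-sym (R v (nb v 0F)) (R v (nb v 1F)) (R v (nb v 2F)))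
      (λ v a b → ∧-trueˡ)
      (λ v → canonicalFor-internal (λ c → R v (nb v c)) (leaving≤1 v))
      (λ v → canonicalFor-contacts (λ c → R v (nb v c)) (leaving≤1 v))

theorem3 : (n : ℕ) (adj : Adj n) → IsSimpleGraph adj → IsCubic adj →
    (σ : Fin n → Fin n → Fin 3) → IsContactAssignment adj σ →
    HasEfficientEDS adj ⇔
    Σ (Adj (n * 12)) (λ P → IsPerfectEDS (magnification adj σ) P × 10 * edgeCount P ≤ 57 * n)
theorem3 n adj simple cubic σ assignment = mk⇔ expand contract
  where open Magnification simple cubic σ assignment
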